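{- Let $G$ and $H$ be oriented graphs that are orthogonal and homomorphically incomparable (i.e. there is no homomorphism $G\to H$ and no homomorphism $H\to G$). Then the tensor product of their cones, $G^{\triangleleft}\times H^{\triangleleft}$, is a core.
   Context: All digraphs are finite, without loops and without parallel arcs; a pair of opposite arcs $u\to v$, $v\to u$ (a digon) is allowed in a digraph. An oriented graph is a digraph with no digon. A homomorphism $G\to H$ is a map $V(G)\to V(H)$ sending arcs to arcs (preserving direction). The tensor product $G\times H$ has vertex set $V(G)\times V(H)$, with an arc from $(u_1,v_1)$ to $(u_2,v_2)$ iff $u_1\to u_2$ is an arc of $G$ and $v_1\to v_2$ is an arc of $H$. A retract of $G$ is an endomorphism $\phi:G\to G$ with $\phi^2=\phi$; $G$ is a core if its only retract is the identity (equivalently, it is not homomorphically equivalent to any digraph with fewer vertices). $G$ and $H$ are orthogonal if every homomorphism $G\times H\to G$ is surjective on vertices and every homomorphism $G\times H\to H$ is surjective on vertices. The cone $G^{\triangleleft}$ of a digraph $G$ is obtained from $G$ by adding one new vertex $\star_G$ (the apex), joined by arcs in both directions to every vertex of $G$. -}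

module Defs where

open import Data.Fin.Base using (Fin; zero; suc)
open import Data.Fin.Properties using (*↔×)
open import Data.Maybe.Base using (Maybe; just; nothing)
open import Data.Nat.Base using (ℕ)
import Data.Nat.Base as ℕ
open import Data.Product.Base using (∃; _×_; _,_)
open import Data.Product.Function.NonDependent.Propositional using (_×-↔_)
open import Data.Product.Relation.Binary.Pointwise.NonDependent using (Pointwise; ×-decidable)
open import Function.Base using (id; _∘_)
open import Function.Bundles using (_↔_; mk↔ₛ′; Inverse)
open import Function.Construct.Composition using (_↔-∘_)
open import Function.Construct.Symmetry using (↔-sym)
open import Function.Definitions using (Surjective)
open import Level using (0ℓ)
open import Relation.Binary.Core using (Rel; _=[_]⇒_)
open import Relation.Binary.Definitions using (Decidable; Irreflexive; Asymmetric)
open import Relation.Binary.PropositionalEquality using (_≡_; _≗_; refl; cong)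
open import Relation.Nullary using (¬_; yes; no)
import Relation.Nullary.Decidable as Dec

-- Arcs form a relation that is only ever used up to inhabitation, so there
-- are no parallel arcs. Decidability of arcs is part of finiteness.
record Digraph : Set₁ where
  field
    Vertex   : Set
    size     : ℕ
    finite   : Vertex ↔ Fin size
    Arc      : Rel Vertex 0ℓ
    arc?     : Decidable Arc
    loopless : Irreflexive _≡_ Arc

open Digraph public

Oriented : Digraph → Set
Oriented G = Asymmetric (Arc G)

IsHomomorphism : (G H : Digraph) → (Vertex G → Vertex H) → Set
IsHomomorphism G H f = Arc G =[ f ]⇒ Arc H

Homomorphism : Digraph → Digraph → Set
Homomorphism G H = ∃ (IsHomomorphism G H)

Incomparable : Digraph → Digraph → Set
Incomparable G H = ¬ Homomorphism G H × ¬ Homomorphism H G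

record IsRetract (G : Digraph) (φ : Vertex G → Vertex G) : Set where
  field
    isHomomorphism : IsHomomorphism G G φ
    idempotent     : φ ∘ φ ≗ φ

IsCore : Digraph → Set
IsCore G = ∀ φ → IsRetract G φ → φ ≗ id

infixr 7 _⊗_

_⊗_ : Digraph → Digraph → Digraph
G ⊗ H = record
  { Vertex   = Vertex G × Vertex H
  ; size     = size G ℕ.* size H
  ; finite   = ↔-sym *↔× ↔-∘ (finite G ×-↔ finite H)
  ; Arc      = Pointwise (Arc G) (Arc H)
  ; arc?     = ×-decidable (arc? G) (arc? H)
  ; loopless = λ { refl (a , _) → loopless G refl a }
  }

Orthogonal : Digraph → Digraph → Set
Orthogonal G H =
  (∀ f → IsHomomorphism (G ⊗ H) G f → Surjective _≡_ _≡_ f) ×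
  (∀ f → IsHomomorphism (G ⊗ H) H f → Surjective _≡_ _≡_ f)

pattern ⋆ = nothing

data ConeArc (G : Digraph) : Rel (Maybe (Vertex G)) 0ℓ where
  base      : ∀ {u v} → Arc G u v → ConeArc G (just u) (just v)
  from-apex : ∀ {v} → ConeArc G ⋆ (just v)
  to-apex   : ∀ {u} → ConeArc G (just u) ⋆

coneArc? : (G : Digraph) → Decidable (ConeArc G)
coneArc? G (just u) (just v) = Dec.map′ base (λ { (base a) → a }) (arc? G u v)
coneArc? G (just _) ⋆        = yes to-apex
coneArc? G ⋆        (just _) = yes from-apex
coneArc? G ⋆        ⋆        = no λ ()

coneFinite : ∀ {A : Set} {n} → A ↔ Fin n → Maybe A ↔ Fin (ℕ.suc n)
coneFinite {A} {n} A↔Fin = mk↔ₛ′ to′ from′ to∘from from∘to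
  where
  open Inverse A↔Fin using (to; from; strictlyInverseˡ; strictlyInverseʳ)

  to′ : Maybe A → Fin (ℕ.suc n)
  to′ (just x) = suc (to x)
  to′ nothing  = zero

  from′ : Fin (ℕ.suc n) → Maybe A
  from′ zero    = nothing
  from′ (suc i) = just (from i)

  to∘from : ∀ i → to′ (from′ i) ≡ i
  to∘from zero    = refl
  to∘from (suc i) = cong suc (strictlyInverseˡ i)

  from∘to : ∀ x → from′ (to′ x) ≡ x
  from∘to (just x) = cong just (strictlyInverseʳ x)
  from∘to nothing  = refl

infix 8 _◁

_◁ : Digraph → Digraph
G ◁ = record
  { Vertex   = Maybe (Vertex G)
  ; size     = ℕ.suc (size G)
  ; finite   = coneFinite (finite G)
  ; Arc      = ConeArc G
  ; arc?     = coneArc? G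
  ; loopless = λ { refl (base a) → loopless G refl a }
  }

{-# OPTIONS --safe #-}

-- Since G and H are oriented, the digons of the product of the cones are
-- exactly the pairs (⋆ , ⋆) – (u , v) and (u , ⋆) – (⋆ , v), so along a digon
-- each coordinate switches between apex and base. This determines up to a few
-- cases which kind of vertex a retract φ sends to which; idempotence and the
-- existence of arcs in G and H leave only the case where φ preserves kinds and
-- those where φ moves all (u , ⋆), or all (⋆ , v), into the base G × H.
-- The restriction of φ to G × H gives homomorphisms to G and to H, which are
-- surjective by orthogonality; hence over each vertex of G lies a fixed point
-- of φ in G × H, and the first coordinate of φ (u , ⋆) dominates u (has all
-- its in- and out-neighbours). Orthogonality also makes G rigid, in that only u
-- dominates u: otherwise the map that moves just u to w, composed with the
-- projection, would miss u. So φ fixes first coordinates. If φ moves each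
-- (u , ⋆) into G × H, its second coordinate is then a homomorphism G → H;
-- otherwise, by symmetry, φ is the identity.
module Submission where

open import Defs

open import Data.Bool.Base using (Bool; true; false; not)
open import Data.Empty using (⊥; ⊥-elim)
open import Data.Fin.Properties using (any?) renaming (_≟_ to _≟ᶠ_)
open import Data.Maybe.Base using (Maybe; just; is-just)
open import Data.Product.Base using (∃; ∃₂; _×_; _,_; proj₁; proj₂; swap; map)
open import Data.Unit.Base using (⊤; tt)
open import Function.Base using (id; _∘_; const)
open import Function.Bundles using (Inverse)
open import Function.Definitions using (Surjective)
open import Function.Properties.Inverse using (↔⇒↣)
open import Relation.Binary.Definitions using (DecidableEquality)
open import Relation.Binary.PropositionalEquality
open import Relation.Nullary using (¬_; Dec; yes; no; contradiction)
open import Relation.Nullary.Decidable using (map′; via-injection)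
open import Relation.Unary using (Decidable)

vertex-≟ : (G : Digraph) → DecidableEquality (Vertex G)
vertex-≟ G = via-injection (↔⇒↣ (finite G)) _≟ᶠ_

any-vertex? : (G : Digraph) {P : Vertex G → Set} → Decidable P → Dec (∃ P)
any-vertex? G {P} P? = map′
  (λ (i , p) → from i , p)
  (λ (v , p) → to v , subst P (sym (strictlyInverseʳ v)) p)
  (any? (P? ∘ from))
  where open Inverse (finite G)

-- Were `G` arcless, a constant map into `H` would be a homomorphism or, with `H` empty, the empty
-- map into `G`.
incomparable⇒arc : (G H : Digraph) → Incomparable G H → ∃₂ (Arc G)
incomparable⇒arc G H (G↛H , H↛G)
  with any-vertex? G (λ u → any-vertex? G (arc? G u))
... | yes arc = arc
... | no ¬arc with any-vertex? H {λ _ → ⊤} (λ _ → yes tt)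
...   | yes (v , _) = contradiction (const v , λ {_} {_} a → ⊥-elim (¬arc (_ , _ , a))) G↛H
...   | no ¬v       = contradiction ((λ v → ⊥-elim (¬v (v , tt))) , λ {v} {_} _ → ⊥-elim (¬v (v , tt))) H↛G

SurjectiveFrom⊗ : Digraph → Digraph → Set
SurjectiveFrom⊗ G H = ∀ f → IsHomomorphism (G ⊗ H) G f → Surjective _≡_ _≡_ f

Dominates : (G : Digraph) → Vertex G → Vertex G → Set
Dominates G w u = ∀ x → (Arc G u x → Arc G w x) × (Arc G x u → Arc G x w)

dominates⇒≡ : (G H : Digraph) → SurjectiveFrom⊗ G H →
  ∀ {w u} → Dominates G w u → w ≡ u
dominates⇒≡ G H surj {w} {u} dom = w≡u (surj (move ∘ proj₁) (move-hom ∘ proj₁) u)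
  where
  _≟_ = vertex-≟ G

  move : Vertex G → Vertex G
  move x with x ≟ u
  ... | yes _ = w
  ... | no  _ = x

  move-hom : IsHomomorphism G G move
  move-hom {x} {y} a with x ≟ u | y ≟ u
  ... | yes refl | yes refl = ⊥-elim (loopless G refl a)
  ... | yes refl | no  _    = proj₁ (dom y) a
  ... | no  _    | yes refl = proj₂ (dom x) a
  ... | no  _    | no  _    = a

  w≡u : (∃ λ x → ∀ {z} → z ≡ x → move (proj₁ z) ≡ u) → w ≡ u
  w≡u ((x , _) , hit) with x ≟ u | hit refl
  ... | yes _   | w≡u = w≡u
  ... | no  x≢u | x≡u = contradiction x≡u x≢u

-- In a cone: true on base vertices, false on the apex.
Kind : Set
Kind = Bool × Bool

flip : Kind → Kind
flip = map not not

kind : ∀ {A B : Set} → Maybe A × Maybe B → Kind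
kind = map is-just is-just

is-just⇒just : ∀ {A : Set} {m : Maybe A} → is-just m ≡ true → ∃ λ a → m ≡ just a
is-just⇒just {m = just a} _ = a , refl

is-just⇒⋆ : ∀ {A : Set} {m : Maybe A} → is-just m ≡ false → m ≡ ⋆
is-just⇒⋆ {m = ⋆} _ = refl

¬apex-arc : ∀ {G x y} → ConeArc G x y → is-just x ≡ false → is-just y ≡ false → ⊥
¬apex-arc (base _)  () _
¬apex-arc from-apex _  ()
¬apex-arc to-apex   () _

base-arc : ∀ {G x y u v} → ConeArc G x y → x ≡ just u → y ≡ just v → Arc G u v
base-arc (base a) refl refl = a

cone-digon : ∀ {G x y} → Oriented G → ConeArc G x y → ConeArc G y x →
  is-just y ≡ not (is-just x)
cone-digon asym (base a)  (base b) = ⊥-elim (asym a b)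
cone-digon asym from-apex _        = refl
cone-digon asym to-apex   _        = refl

module ConeRetract
  (G H : Digraph) (asymG : Oriented G) (asymH : Oriented H)
  (φ : Vertex (G ◁ ⊗ H ◁) → Vertex (G ◁ ⊗ H ◁)) (retract : IsRetract (G ◁ ⊗ H ◁) φ)
  where

  open IsRetract retract

  P : Digraph
  P = G ◁ ⊗ H ◁

  flips : ∀ {x y} → Arc P x y → Arc P y x → kind (φ y) ≡ flip (kind (φ x))
  flips a b = cong₂ _,_ (cone-digon asymG (proj₁ φa) (proj₁ φb))
                        (cone-digon asymH (proj₂ φa) (proj₂ φb))
    where
    φa = isHomomorphism a
    φb = isHomomorphism b

  flips-base : ∀ u v → kind (φ (just u , just v)) ≡ flip (kind (φ (⋆ , ⋆)))
  flips-base u v = flips (from-apex , from-apex) (to-apex , to-apex)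

  flips-right : ∀ u v → kind (φ (⋆ , just v)) ≡ flip (kind (φ (just u , ⋆)))
  flips-right u v = flips (to-apex , from-apex) (from-apex , to-apex)

  flips-left : ∀ u v → kind (φ (just u , ⋆)) ≡ flip (kind (φ (⋆ , just v)))
  flips-left u v = flips (from-apex , to-apex) (to-apex , from-apex)

  -- Values of `φ` are fixed points; the next lemmas play this against the kinds that digons force.
  kind-image : ∀ {x y} → φ x ≡ y → kind (φ y) ≡ kind y
  kind-image {x} refl = cong kind (idempotent x)

  apex↦̸base : ∀ {u v} → φ (⋆ , ⋆) ≢ (just u , just v)
  apex↦̸base {u} {v} eq with () ←
    trans (sym (kind-image eq)) (trans (flips-base u v) (cong (flip ∘ kind) eq))

  -- For `v → v′` in `H`, both ends of the arc from `(⋆ , just v)` to `(just u , just v′)` would be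
  -- sent over the apex of `G ◁`: the first because `(just u , ⋆)` is fixed, the second by its digon
  -- with `(⋆ , ⋆)`.
  apex↦̸left : ∃₂ (Arc H) → ∀ {u} → φ (⋆ , ⋆) ≢ (just u , ⋆)
  apex↦̸left (v , v′ , v→v′) {u} eq = ¬apex-arc
    (proj₁ (isHomomorphism {⋆ , just v} {just u , just v′} (from-apex , base v→v′)))
    (cong proj₁ (trans (flips-right u v) (cong flip (kind-image eq))))
    (cong proj₁ (trans (flips-base u v′) (cong (flip ∘ kind) eq)))

  left↦̸right : ∀ {u v} → φ (just u , ⋆) ≢ (⋆ , just v)
  left↦̸right {u} {v} eq with () ←
    trans (sym (kind-image eq)) (trans (flips-right u v) (cong (flip ∘ kind) eq))

  module FixedApex (surj : SurjectiveFrom⊗ G H) (fixed-apex : φ (⋆ , ⋆) ≡ (⋆ , ⋆)) where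

    φ-base : ∀ u v → ∃₂ λ u′ v′ → φ (just u , just v) ≡ (just u′ , just v′)
    φ-base u v =
      let k        = trans (flips-base u v) (cong (flip ∘ kind) fixed-apex)
          (_ , p≡) = is-just⇒just (cong proj₁ k)
          (_ , q≡) = is-just⇒just (cong proj₂ k)
      in _ , _ , cong₂ _,_ p≡ q≡

    fixed-over : ∀ u → ∃ λ v → φ (just u , just v) ≡ (just u , just v)
    fixed-over u = fixed (surj p p-hom u)
      where
      p : Vertex (G ⊗ H) → Vertex G
      p (x , y) = proj₁ (φ-base x y)

      φ≡p : ∀ x → proj₁ (φ (map just just x)) ≡ just (p x)
      φ≡p (x , y) = cong proj₁ (proj₂ (proj₂ (φ-base x y)))

      p-hom : IsHomomorphism (G ⊗ H) G p
      p-hom {x} {y} (a , b) = base-arc (proj₁ (isHomomorphism (base a , base b))) (φ≡p x) (φ≡p y)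

      fixed : (∃ λ x → ∀ {z} → z ≡ x → p z ≡ u) →
        ∃ λ v → φ (just u , just v) ≡ (just u , just v)
      fixed ((x , y) , hit) =
        let (_ , v , φ≡pv) = φ-base x y
        in v , subst (λ z → φ z ≡ z) (trans φ≡pv (cong (λ u′ → just u′ , just v) (hit refl)))
                     (idempotent (just x , just y))

    FixesFirst : Vertex G → Maybe (Vertex H) → Set
    FixesFirst u y = proj₁ (φ (just u , y)) ≡ just u

    -- Since `y` and `z` form a digon, an arc between `u` and `x` in `G` lifts, in the same
    -- direction, to one between `(just u , y)` and `(just x , z)`. As `φ` keeps the first
    -- coordinate of the latter, that of `φ (just u , y)` dominates `u`.
    fixes-first : ∀ y →
      (∀ u → ∃ λ z → ConeArc H y z × ConeArc H z y × FixesFirst u z) →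
      ∀ u → is-just (proj₁ (φ (just u , y))) ≡ true → FixesFirst u y
    fixes-first y nbr u k = trans φ≡w (cong just (dominates⇒≡ G H surj dominates))
      where
      φ≡w = proj₂ (is-just⇒just k)

      dominates : Dominates G (proj₁ (is-just⇒just k)) u
      dominates x =
        let (_ , y→z , z→y , fixed) = nbr x
        in (λ u→x → base-arc (proj₁ (isHomomorphism (base u→x , y→z))) φ≡w fixed)
         , (λ x→u → base-arc (proj₁ (isHomomorphism (base x→u , z→y))) fixed φ≡w)

    fixes-first-left : ∀ u → is-just (proj₁ (φ (just u , ⋆))) ≡ true → FixesFirst u ⋆
    fixes-first-left = fixes-first ⋆ λ u →
      let (v , fixed) = fixed-over u in just v , from-apex , to-apex , cong proj₁ fixed

    fixes-first-base : (∀ u → FixesFirst u ⋆) → ∀ u v → FixesFirst u (just v)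
    fixes-first-base left u v = fixes-first (just v)
      (λ u′ → ⋆ , to-apex , from-apex , left u′) u
      (cong is-just (cong proj₁ (proj₂ (proj₂ (φ-base u v)))))

    left↦base⇒homomorphism : (∀ u → kind (φ (just u , ⋆)) ≡ (true , true)) → Homomorphism G H
    left↦base⇒homomorphism k = h , h-hom
      where
      second : ∀ u → ∃ λ v → proj₂ (φ (just u , ⋆)) ≡ just v
      second u = is-just⇒just (cong proj₂ (k u))

      h : Vertex G → Vertex H
      h = proj₁ ∘ second

      φ-left : ∀ u → φ (just u , ⋆) ≡ (just u , just (h u))
      φ-left u = cong₂ _,_ (fixes-first-left u (cong proj₁ (k u))) (proj₂ (second u))

      h-hom : IsHomomorphism G H h
      h-hom {u} {u′} u→u′ = base-arc
        -- This arc ends at `φ (just u′ , ⋆)`, which is fixed, so the second coordinate of its image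
        -- runs from `h u` to `h u′`.
        (proj₂ (isHomomorphism {just u , ⋆} {just u′ , just (h u′)} (base u→u′ , from-apex)))
        (cong proj₂ (φ-left u))
        (cong proj₂ (subst (λ z → φ z ≡ z) (φ-left u′) (idempotent (just u′ , ⋆))))

swap-retract : (G H : Digraph) → ∀ {φ} → IsRetract (G ⊗ H) φ → IsRetract (H ⊗ G) (swap ∘ φ ∘ swap)
swap-retract G H retract = record
  { isHomomorphism = swap ∘ isHomomorphism ∘ swap
  ; idempotent     = cong swap ∘ idempotent ∘ swap
  }
  where open IsRetract retract

theorem36 : (G H : Digraph) → Oriented G → Oriented H →
    Orthogonal G H → Incomparable G H → IsCore (G ◁ ⊗ H ◁)
theorem36 G H asymG asymH (surjG , surjH) incomp@(G↛H , H↛G) φ retract = φ≗id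
  where
  module L = ConeRetract G H asymG asymH φ retract
  -- Exchanging the factors makes every result on first coordinates available for second ones.
  module R = ConeRetract H G asymH asymG (swap ∘ φ ∘ swap) (swap-retract (G ◁) (H ◁) retract)

  arcG = incomparable⇒arc G H incomp
  arcH = incomparable⇒arc H G (swap incomp)
  u₀   = proj₁ arcG
  v₀   = proj₁ arcH

  fixed-apex : φ (⋆ , ⋆) ≡ (⋆ , ⋆)
  fixed-apex with φ (⋆ , ⋆) in eq
  ... | just _ , just _ = contradiction eq L.apex↦̸base
  ... | just _ , ⋆      = contradiction eq (L.apex↦̸left arcH)
  ... | ⋆ , just _      = contradiction (cong swap eq) (R.apex↦̸left arcG)
  ... | ⋆ , ⋆           = refl

  surjH′ : SurjectiveFrom⊗ H G
  surjH′ f hom v with surjH (f ∘ swap) (hom ∘ swap) v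
  ... | x , hit = swap x , λ { refl → hit refl }

  module LF = L.FixedApex surjG fixed-apex
  module RF = R.FixedApex surjH′ (cong swap fixed-apex)

  kind-left₀ : kind (φ (just u₀ , ⋆)) ≡ (true , false)
  kind-left₀ with φ (just u₀ , ⋆) in eq
  ... | just _ , ⋆      = refl
  ... | ⋆ , just _      = contradiction eq L.left↦̸right
  -- Every `(just u , ⋆)` forms a digon with `(⋆ , just v₀)`, so all of them share the kind of the
  -- value at `u₀`.
  ... | just _ , just _ = contradiction (LF.left↦base⇒homomorphism λ u →
          trans (L.flips-left u v₀) (cong flip (trans (L.flips-right u₀ v₀) (cong (flip ∘ kind) eq)))) G↛H
  -- Flipping now puts the value at each `(⋆ , just v)` into the base, which gives a homomorphism
  -- from `H` to `G`.
  ... | ⋆ , ⋆           = contradiction (RF.left↦base⇒homomorphism λ v →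
          cong swap (trans (L.flips-right u₀ v) (cong (flip ∘ kind) eq))) H↛G

  kind-right : ∀ v → kind (φ (⋆ , just v)) ≡ (false , true)
  kind-right v = trans (L.flips-right u₀ v) (cong flip kind-left₀)

  kind-left : ∀ u → kind (φ (just u , ⋆)) ≡ (true , false)
  kind-left u = trans (L.flips-left u v₀) (cong flip (kind-right v₀))

  left : ∀ u → LF.FixesFirst u ⋆
  left u = LF.fixes-first-left u (cong proj₁ (kind-left u))

  right : ∀ v → RF.FixesFirst v ⋆
  right v = RF.fixes-first-left v (cong proj₂ (kind-right v))

  φ≗id : φ ≗ id
  φ≗id (just u , just v) = cong₂ _,_ (LF.fixes-first-base left u v) (RF.fixes-first-base right v u)
  φ≗id (just u , ⋆)      = cong₂ _,_ (left u) (is-just⇒⋆ (cong proj₂ (kind-left u)))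
  φ≗id (⋆ , just v)      = cong₂ _,_ (is-just⇒⋆ (cong proj₁ (kind-right v))) (right v)
  φ≗id (⋆ , ⋆)           = fixed-apex
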